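{- The set $\mathcal N$ of nuclear partitions produces the entire set $\mathcal P$ of integer partitions by the decay process. That is, for every $n\geq 0$, every non-nuclear partition of $n$ is produced by the decay of some nuclear partition of $n$.
   Context: $\mathcal P$ denotes the set of integer partitions. A nuclear partition is an integer partition with no part equal to $1$; $\mathcal N\subset\mathcal P$ denotes the set of nuclear partitions. A partition having at least one part equal to $1$ is called non-nuclear. Decay process: a nuclear partition $\mu=(\mu_1,\mu_2,\dots,\mu_r)$ of $n$, $\mu_1\geq\mu_2\geq\dots\geq\mu_r\geq 2$, other than the one-part partition $(n)$, decays into the $\mu_1-\mu_2$ non-nuclear partitions of $n$ obtained by decreasing the largest part $\mu_1$ by a positive integer $j\leq\mu_1-\mu_2$ and adjoining $j$ parts equal to $1$ (if $\mu_1-\mu_2=0$, then $\mu$ is in the "ground state" and does not decay). The one-part nuclear partition $(n)$ decays into the $n-1$ non-nuclear partitions $(n)\to(n-1,1)\to(n-2,1,1)\to\dots\to(1,1,1,\dots,1)$.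
   Formalization: The case n = 1 is excluded: the partition (1) is non-nuclear, but there is no nuclear partition of 1 that could decay into it, so the claim fails there; all other n ≥ 0 are covered. -}

module Defs where

open import Data.Nat using (ℕ; zero; suc; _∸_; _≤_; _≥_; NonZero)
open import Data.List using (List; []; _∷_; _++_; replicate; sum)
open import Data.List.Membership.Propositional using (_∈_; _∉_)
open import Data.List.Relation.Unary.All using (All; []; _∷_)
open import Data.List.Relation.Unary.Any using (here)
open import Data.List.Relation.Unary.Linked using (Linked)
open import Relation.Binary.PropositionalEquality using (_≡_; refl)
open import Relation.Nullary using (¬_)

record Partition (n : ℕ) : Set where
  constructor mkPartition
  field
    parts         : List ℕ
    positive      : All NonZero parts
    nonincreasing : Linked _≥_ parts
    sum-parts     : sum parts ≡ n

open Partition public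

-- The empty partition is nuclear.
Nuclear : ∀ {n} → Partition n → Set
Nuclear μ = 1 ∉ parts μ

NonNuclear : ∀ {n} → Partition n → Set
NonNuclear μ = 1 ∈ parts μ

-- A single decay removes j ≥ 1 from the largest part and adjoins j parts
-- equal to 1.  The relation is stated on lists of parts; it is meant for
-- nuclear sources, whose parts are all ≥ 2, so that putting the new 1s at the
-- end is the nonincreasing arrangement.  The empty partition does not decay,
-- and neither does a partition with μ₁ ≡ μ₂ (the ground state).
data DecaysInto : List ℕ → List ℕ → Set where
  several : ∀ {μ₁ μ₂ μs} j → 1 ≤ j → j ≤ μ₁ ∸ μ₂ →
            DecaysInto (μ₁ ∷ μ₂ ∷ μs) ((μ₁ ∸ j) ∷ μ₂ ∷ μs ++ replicate j 1)
  one     : ∀ {m} j → 1 ≤ j → j ≤ m ∸ 1 →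
            DecaysInto (m ∷ []) ((m ∸ j) ∷ replicate j 1)

infix 4 _⟶_

_⟶_ : ∀ {n} → Partition n → Partition n → Set
μ ⟶ ν = DecaysInto (parts μ) (parts ν)

-- The partition (1) of 1 is non-nuclear, yet there is no nuclear partition of
-- 1 that could produce it; n ≡ 1 is therefore a genuine exception to the claim
-- that decay produces all non-nuclear partitions of n.
no-nuclear-partition-of-1 : (μ : Partition 1) → ¬ Nuclear μ
no-nuclear-partition-of-1 (mkPartition [] _ _ ())
no-nuclear-partition-of-1 (mkPartition (zero ∷ _) (record { nonZero = () } ∷ _) _ _)
no-nuclear-partition-of-1 (mkPartition (suc zero ∷ _) _ _ _) nuclear = nuclear (here refl)
no-nuclear-partition-of-1 (mkPartition (suc (suc _) ∷ _) _ _ ())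

{-# OPTIONS --safe #-}
-- A non-nuclear partition is a ∷ core ++ 1ʲ with all parts of core at least 2;
-- it comes from (a + j) ∷ core, which is nuclear because j ≥ 1.  The all-ones
-- partition fits the pattern with a = 1 and empty core; then j = 0 only
-- if n = 1.
module Submission where

open import Defs
open import Data.Nat using (ℕ; zero; suc; _+_; _∸_; _≤_; _≥_; z≤n; s≤s; NonZero)
open import Data.Nat.ListAction using (sum)
open import Data.Nat.ListAction.Properties using (sum-++)
open import Data.Nat.Properties
  using (≤-trans; ≤-reflexive; +-assoc; +-comm; +-mono-≤; m≤m+n; m+n∸m≡n; m+n∸n≡m; ∸-monoʳ-≤)
open import Data.List using (List; []; _∷_; _++_; replicate)
open import Data.List.Properties using (++-identityʳ)
open import Data.List.Membership.Propositional using (_∈_; _∉_)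
open import Data.List.Relation.Unary.All using (All; []; _∷_; lookup)
import Data.List.Relation.Unary.All as All
open import Data.List.Relation.Unary.Any using (here; there)
open import Data.List.Relation.Unary.Linked using (Linked; []; [-]; _∷_; tail)
open import Data.Product using (Σ-syntax; _×_; _,_; ∃₂)
open import Level using (Level)
open import Relation.Binary.Core using (Rel)
open import Relation.Binary.PropositionalEquality
  using (_≡_; _≢_; refl; sym; trans; cong; subst; module ≡-Reasoning)
open import Relation.Nullary using (contradiction)

private
  variable
    a ℓ : Level
    A : Set a

Linked-++⁻ˡ : {R : Rel A ℓ} (xs : List A) {ys : List A} →
              Linked R (xs ++ ys) → Linked R xs
Linked-++⁻ˡ []           _        = []
Linked-++⁻ˡ (_ ∷ [])     _        = [-]
Linked-++⁻ˡ (_ ∷ y ∷ xs) (r ∷ rs) = r ∷ Linked-++⁻ˡ (y ∷ xs) rs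

Linked-raise-head : ∀ {x y xs} → x ≤ y → Linked _≥_ (x ∷ xs) → Linked _≥_ (y ∷ xs)
Linked-raise-head x≤y [-]      = [-]
Linked-raise-head x≤y (r ∷ rs) = ≤-trans r x≤y ∷ rs

-- Positivity and the absence of 1 in one predicate that can be built part by part; the `positive`
-- field and the nuclearity of the source are both read off from it.
AtLeast2 : List ℕ → Set
AtLeast2 = All (2 ≤_)

AtLeast2⇒1∉ : ∀ {xs} → AtLeast2 xs → 1 ∉ xs
AtLeast2⇒1∉ ps 1∈xs with lookup ps 1∈xs
... | s≤s ()

AtLeast2⇒positive : ∀ {xs} → AtLeast2 xs → All NonZero xs
AtLeast2⇒positive = All.map λ { (s≤s _) → _ }

-- Monotonicity gathers the 1s at the end. In the recursion on the tail, a head of at least 2 joins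
-- the core, while a head equal to 1 forces the core of the tail to be empty.
splitOnes : ∀ {xs} → All NonZero xs → Linked _≥_ xs →
            ∃₂ λ core j → AtLeast2 core × xs ≡ core ++ replicate j 1
splitOnes {[]} _ _ = [] , 0 , [] , refl
splitOnes {x ∷ []} (_ ∷ []) [-] with x
... | suc zero    = [] , 1 , [] , refl
... | suc (suc _) = _ ∷ [] , 0 , s≤s (s≤s z≤n) ∷ [] , refl
splitOnes {x ∷ _ ∷ _} (_ ∷ ps) (r ∷ rs) with splitOnes ps rs
splitOnes {x@(suc (suc _)) ∷ _ ∷ _} _ _ | core , j , twos , eq =
  x ∷ core , j , s≤s (s≤s z≤n) ∷ twos , cong (x ∷_) eq
splitOnes {suc zero ∷ _ ∷ _} _ _ | [] , j , _ , eq = [] , suc j , [] , cong (1 ∷_) eq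
-- Impossible: the order bounds the second part by 1, yet as the first part of the tail's core it is
-- at least 2.
splitOnes {suc zero ∷ _ ∷ _} (_ ∷ _) (s≤s z≤n ∷ _) | _ ∷ _ , _ , s≤s () ∷ _ , refl

sum-replicate-1 : ∀ j → sum (replicate j 1) ≡ j
sum-replicate-1 zero    = refl
sum-replicate-1 (suc j) = cong suc (sum-replicate-1 j)

sum-absorb-ones : ∀ a xs j → sum (a + j ∷ xs) ≡ sum (a ∷ xs ++ replicate j 1)
sum-absorb-ones a xs j = begin
  a + j + sum xs                     ≡⟨ +-assoc a j (sum xs) ⟩
  a + (j + sum xs)                   ≡⟨ cong (a +_) (+-comm j (sum xs)) ⟩
  a + (sum xs + j)                   ≡⟨ cong (λ k → a + (sum xs + k)) (sum-replicate-1 j) ⟨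
  a + (sum xs + sum (replicate j 1)) ≡⟨ cong (a +_) (sum-++ xs (replicate j 1)) ⟨
  a + sum (xs ++ replicate j 1)      ∎
  where open ≡-Reasoning

-- If `core` starts with `b`, the bound `j ≤ a + j ∸ b` required for a decay follows from `b ≤ a`,
-- that is, from the order of `a ∷ core`. For an empty `core`, 1 takes the place of `b`, and `1 ≤ a`
-- is used instead.
decay-absorb-ones : ∀ {a j} core → 1 ≤ a → 1 ≤ j → Linked _≥_ (a ∷ core) →
                    DecaysInto (a + j ∷ core) (a ∷ core ++ replicate j 1)
-- The constructors of `DecaysInto` give the head as `a + j ∸ j`, equal to `a` only propositionally;
-- hence the transport.
decay-absorb-ones {a} {j} core 1≤a 1≤j a∷core = subst
  (λ b → DecaysInto (a + j ∷ core) (b ∷ core ++ replicate j 1)) (m+n∸n≡m a j)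
  (decay core a∷core)
  where
  j≤a+j∸ : ∀ {b} → b ≤ a → j ≤ a + j ∸ b
  j≤a+j∸ b≤a = ≤-trans (≤-reflexive (sym (m+n∸m≡n a j))) (∸-monoʳ-≤ (a + j) b≤a)

  decay : ∀ core → Linked _≥_ (a ∷ core) →
          DecaysInto (a + j ∷ core) (a + j ∸ j ∷ core ++ replicate j 1)
  decay []      _         = one j 1≤j (j≤a+j∸ 1≤a)
  decay (_ ∷ _) (b≤a ∷ _) = several j 1≤j (j≤a+j∸ b≤a)

-- The 1 can only be the head, and a second part would have to be both at least 2 and at most 1.
1∈⇒singleton : ∀ {a xs} → AtLeast2 xs → Linked _≥_ (a ∷ xs) → 1 ∈ a ∷ xs →
               a ∷ xs ≡ 1 ∷ []
1∈⇒singleton twos         rs           (there 1∈xs) = contradiction 1∈xs (AtLeast2⇒1∉ twos)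
1∈⇒singleton []           rs           (here refl)  = refl
1∈⇒singleton (s≤s () ∷ _) (s≤s z≤n ∷ _) (here refl)

mainTheorem3 : (n : ℕ) → n ≢ 1 → (ν : Partition n) → NonNuclear ν →
    Σ[ μ ∈ Partition n ] (Nuclear μ × μ ⟶ ν)
mainTheorem3 _ n≢1 (mkPartition (suc a ∷ xs) (_ ∷ ps) rs refl) 1∈ν
  -- Only the tail is split: the head must remain as what is left of the decayed part, even when it
  -- is itself 1.
  with splitOnes ps (tail rs)
... | core , suc j , twos , refl =
  mkPartition (suc a + suc j ∷ core) (AtLeast2⇒positive twos′)
    (Linked-raise-head (m≤m+n (suc a) (suc j)) a∷core)
    (sum-absorb-ones (suc a) core (suc j)) ,
  AtLeast2⇒1∉ twos′ ,
  decay-absorb-ones core (s≤s z≤n) (s≤s z≤n) a∷core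
  where
  a∷core : Linked _≥_ (suc a ∷ core)
  a∷core = Linked-++⁻ˡ (suc a ∷ core) rs

  twos′ : AtLeast2 (suc a + suc j ∷ core)
  twos′ = +-mono-≤ (s≤s (z≤n {a})) (s≤s (z≤n {j})) ∷ twos
... | core , zero , twos , refl =
  -- With no 1s after the head, `ν` is the partition (1), and taking sums gives the excluded value
  -- of `n`.
  contradiction (cong sum (trans (cong (suc a ∷_) (++-identityʳ core)) a∷core≡[1])) n≢1
  where
  a∷core≡[1] : suc a ∷ core ≡ 1 ∷ []
  a∷core≡[1] = 1∈⇒singleton twos (Linked-++⁻ˡ (suc a ∷ core) rs)
    (subst (λ xs → 1 ∈ suc a ∷ xs) (++-identityʳ core) 1∈ν)
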